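{- Let $k\ge 2$, let $H$ be a digraph (possibly with loops), and let $D$ be an $H$-colored local out-tournament. If every directed cycle in $D$ has $H$-length at most $k-2$, then $D$ has a $(k,H)$-kernel.
   Context: All digraphs are finite. A local out-tournament is a digraph $D$ such that for every vertex $x$, the subdigraph induced by the out-neighbourhood $N^+(x)$ is a tournament (every two distinct vertices joined by exactly one arc). $D$ has no loops and comes with a map $\rho: A(D)\to V(H)$. For a walk $W=(x_0,\ldots,x_n)$ in $D$, there is an obstruction on $x_i$ if $(\rho(x_{i-1},x_i),\rho(x_i,x_{i+1})) \notin A(H)$; for an open walk this is considered at internal vertices $x_i$, $1\le i\le n-1$, for a closed walk (such as a cycle) at all $i\in\{0,\ldots,n-1\}$ with indices modulo $n$. $O_H(W)$ is the set of indices with an obstruction; the $H$-length is $l_H(W)=|O_H(W)|+1$ for open $W$ and $|O_H(W)|$ for closed $W$. A $(k,H)$-kernel ($k\ge2$) is a set $S\subseteq V(D)$ such that for every two distinct $u,v\in S$ every directed $uv$-path in $D$ has $H$-length at least $k$, and for every $x\in V(D)\setminus S$ there is a directed path from $x$ to a vertex of $S$ of $H$-length at most $k-1$. -}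

module Defs where

open import Data.Bool.Base using (Bool; T)
open import Data.Bool.Properties using (T?)
open import Data.Fin.Base using (Fin)
open import Data.Fin.Subset using (Subset; _∈_; _∉_)
open import Data.List.Base using (List; []; _∷_; _∷ʳ_; _++_; length; zip; drop; take; filter)
open import Data.List.Relation.Unary.Unique.Propositional using (Unique)
open import Data.Nat.Base using (ℕ; suc; _≤_; _∸_)
open import Data.Product.Base using (_×_; _,_; ∃-syntax; Σ-syntax)
open import Data.Sum.Base using (_⊎_)
open import Level using (0ℓ)
open import Relation.Binary.Construct.Closure.ReflexiveTransitive using (Star; ε; _◅_)
open import Relation.Binary.PropositionalEquality using (_≢_)
open import Relation.Nullary using (¬_; ¬?)
open import Relation.Unary using (Pred)

-- Boolean adjacency gives at most one arc for each ordered pair of vertices.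
-- Loops and pairs of opposite arcs are not excluded here.
record Digraph : Set where
  field
    order : ℕ
    adj   : Fin order → Fin order → Bool

open Digraph public

Vertex : Digraph → Set
Vertex D = Fin (order D)

Arc : (D : Digraph) → Vertex D → Vertex D → Set
Arc D x y = T (adj D x y)

Loopless : Digraph → Set
Loopless D = ∀ x → ¬ Arc D x x

InducesTournament : (D : Digraph) → Pred (Vertex D) 0ℓ → Set
InducesTournament D P =
  (∀ x → P x → ¬ Arc D x x) ×
  (∀ x y → P x → P y → x ≢ y →
    (Arc D x y × ¬ Arc D y x) ⊎ (Arc D y x × ¬ Arc D x y))

LocalOutTournament : Digraph → Set
LocalOutTournament D = ∀ x → InducesTournament D (Arc D x)

Walk : (D : Digraph) → Vertex D → Vertex D → Set
Walk D = Star (Arc D)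

-- For W = (x₀, …, xₙ) this is x₀, …, xₙ₋₁.
initials : ∀ D {x y} → Walk D x y → List (Vertex D)
initials D ε             = []
initials D (_◅_ {x} _ W) = x ∷ initials D W

IsPath : ∀ D {x y} → Walk D x y → Set
IsPath D {y = y} W = Unique (initials D W ∷ʳ y)

IsCycle : ∀ D {x} → Walk D x x → Set
IsCycle D W = 1 ≤ length (initials D W) × Unique (initials D W)

Colouring : Digraph → Digraph → Set
Colouring D H = ∀ x y → Arc D x y → Vertex H

module _ (D H : Digraph) (ρ : Colouring D H) where

  colours : ∀ {x y} → Walk D x y → List (Vertex H)
  colours ε                 = []
  colours (_◅_ {x} {y} a W) = ρ x y a ∷ colours W

  -- The pairs (ρ(xᵢ₋₁,xᵢ) , ρ(xᵢ,xᵢ₊₁)), in the order i = 1, …, n-1.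
  openTransitions : ∀ {x y} → Walk D x y → List (Vertex H × Vertex H)
  openTransitions W = zip (colours W) (drop 1 (colours W))

  -- The same pairs with indices modulo n, in the order i = 1, …, n-1, 0.
  closedTransitions : ∀ {x} → Walk D x x → List (Vertex H × Vertex H)
  closedTransitions W =
    zip (colours W) (drop 1 (colours W) ++ take 1 (colours W))

  -- One list entry per index i, so the length of the result is ∣O_H(W)∣
  -- even if the same pair of colours occurs at several indices.
  obstructions : List (Vertex H × Vertex H) → List (Vertex H × Vertex H)
  obstructions = filter λ (c , d) → ¬? (T? (adj H c d))

  openHLength : ∀ {x y} → Walk D x y → ℕ
  openHLength W = suc (length (obstructions (openTransitions W)))

  closedHLength : ∀ {x} → Walk D x x → ℕ
  closedHLength W = length (obstructions (closedTransitions W))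

  Independent : ℕ → Subset (order D) → Set
  Independent k S = ∀ u v → u ∈ S → v ∈ S → u ≢ v →
    (W : Walk D u v) → IsPath D W → k ≤ openHLength W

  Absorbent : ℕ → Subset (order D) → Set
  Absorbent k S = ∀ x → x ∉ S →
    ∃[ s ] s ∈ S × (Σ[ W ∈ Walk D x s ] IsPath D W × openHLength W ≤ k ∸ 1)

  IsKernel : ℕ → Subset (order D) → Set
  IsKernel k S = Independent k S × Absorbent k S

{-# OPTIONS --safe #-}

-- Write u ⇝ v when some path from u to v has H-length at most k - 1; a
-- (k,H)-kernel is a kernel of the relation ⇝.  If a cycle C of a local
-- out-tournament is left by an arc to y and y reaches C again, then some cycle
-- contains y and all of C: either y fits between two consecutive vertices of C,
-- or every vertex of C dominates y and a path from y back to C closes up.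
-- Hence two vertices of one strong component lie on a common cycle, whose
-- H-length is at most k - 2, so they are joined by ⇝ in both directions.  The
-- asymmetric part of ⇝ is therefore acyclic, and a kernel of ⇝ is found greedily.
module Submission where

open import Defs
open import Data.Bool.Properties using (T?; T-irrelevant)
open import Data.Fin.Base as Fin using (Fin; zero; suc)
open import Data.Fin.Induction using (spo-wellFounded)
open import Data.Fin.Properties as Fin using (any?; injective⇒≤)
open import Data.Fin.Subset using (_∈_; _∉_)
open import Data.List.Base using (List; []; _∷_; [_]; _∷ʳ_; _++_; length; zip; drop; lookup)
open import Data.List.Membership.Propositional using () renaming (_∈_ to _∈ₗ_; _∉_ to _∉ₗ_)
open import Data.List.Membership.Propositional.Properties using (∈-lookup; ∈-length; ∈-++⁺ʳ; ∈-++⁻)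
open import Data.List.Properties using (++-assoc)
open import Data.List.Relation.Binary.Disjoint.Propositional using (Disjoint)
open import Data.List.Relation.Binary.Permutation.Propositional
  using (_↭_; ↭-refl; ↭-sym; ↭-trans; prep; swap; ↭-reflexive; ↭⇒↭ₛ)
open import Data.List.Relation.Binary.Permutation.Propositional.Properties using (∈-resp-↭; All-resp-↭; ↭-length; ++-comm)
import Data.List.Relation.Binary.Permutation.Setoid.Properties as Permutation
open import Data.List.Relation.Binary.Sublist.Propositional using (_⊆_; []; _∷_; ⊆-refl; minimum) renaming (_∷ʳ_ to _∷ˢ_)
open import Data.List.Relation.Binary.Sublist.Propositional.Properties
  using (All-resp-⊆; ++⁺; ++⁺ˡ; ++⁺ʳ; filter⁺; length-mono-≤)
open import Data.List.Relation.Unary.All as All using (All; []; _∷_)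
open import Data.List.Relation.Unary.All.Properties using (¬Any⇒All¬)
open import Data.List.Relation.Unary.Any using (here; there)
open import Data.List.Relation.Unary.Unique.Propositional using (Unique; []; _∷_)
import Data.List.Relation.Unary.Unique.DecPropositional as DecUnique
import Data.List.Relation.Unary.Unique.Propositional.Properties as Unique
open import Data.Nat.Base using (ℕ; zero; suc; _≤_; _∸_; z≤n; s≤s)
open import Data.Nat.Properties using (≤-trans; _≤?_; ≰⇒>)
open import Data.Product.Base using (_×_; _,_; proj₁; proj₂; ∃-syntax; Σ-syntax)
open import Data.Sum.Base using (_⊎_; inj₁; inj₂)
open import Data.Vec.Base using (tabulate)
open import Data.Vec.Properties using (lookup∘tabulate; lookup⇒[]=; []=⇒lookup)
open import Function.Base using (_∘_; id)
open import Induction.WellFounded using (WellFounded; Acc; acc; module Subrelation)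
open import Relation.Binary.Construct.Closure.ReflexiveTransitive using (ε; _◅_; _◅◅_)
open import Relation.Binary.Core using (Rel)
open import Relation.Binary.Definitions using (Decidable; Transitive; tri<; tri≈; tri>)
open import Relation.Binary.PropositionalEquality
  using (_≡_; _≢_; refl; sym; trans; cong; subst; setoid; resp₂; isEquivalence)
open import Relation.Binary.Structures using (IsStrictPartialOrder)
open import Relation.Nullary using (¬_; Dec; yes; no; does; contradiction)
open import Relation.Nullary.Decidable using (map′; _×-dec_; _→-dec_; dec-true)
open import Relation.Unary using (Pred) renaming (Decidable to Decidable₁)
open import Level using (0ℓ)

-- Duplicate-free lists and lists of consecutive pairs.

module _ {A : Set} where

  Unique-resp-⊇ : {xs ys : List A} → xs ⊆ ys → Unique ys → Unique xs
  Unique-resp-⊇ []         []         = []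
  Unique-resp-⊇ (_ ∷ˢ p)   (_ ∷ u)    = Unique-resp-⊇ p u
  Unique-resp-⊇ (refl ∷ p) (x≢ys ∷ u) = All-resp-⊆ p x≢ys ∷ Unique-resp-⊇ p u

  Unique-resp-↭ : {xs ys : List A} → xs ↭ ys → Unique xs → Unique ys
  Unique-resp-↭ p = Permutation.Unique-resp-↭ (setoid A) (↭⇒↭ₛ p)

  Unique⇒lookup-injective : {xs : List A} → Unique xs →
    ∀ {i j} → lookup xs i ≡ lookup xs j → i ≡ j
  Unique⇒lookup-injective (_ ∷ _)    {zero}  {zero}  _  = refl
  Unique⇒lookup-injective (x≢xs ∷ _) {zero}  {suc j} eq = contradiction eq (All.lookup x≢xs (∈-lookup j))
  Unique⇒lookup-injective (x≢xs ∷ _) {suc i} {zero}  eq = contradiction (sym eq) (All.lookup x≢xs (∈-lookup i))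
  Unique⇒lookup-injective (_ ∷ u)    {suc i} {suc j} eq = cong suc (Unique⇒lookup-injective u eq)

  zip-⊆ : (as bs cs ds : List A) → zip as cs ⊆ zip (as ++ bs) (cs ++ ds)
  zip-⊆ []       bs cs       ds = minimum _
  zip-⊆ (a ∷ as) bs []       ds = minimum _
  zip-⊆ (a ∷ as) bs (c ∷ cs) ds = refl ∷ zip-⊆ as bs cs ds

  -- Meant for `cs` the colours of an open walk, `ds` those of a walk closing it up, and `es` the
  -- wrapped-around first colour: every transition inside the open walk recurs in the closed one.
  consecutive-⊆ : (cs ds es : List A) →
    zip cs (drop 1 cs) ⊆ zip (cs ++ ds) (drop 1 (cs ++ ds) ++ es)
  consecutive-⊆ []       ds es = minimum _
  consecutive-⊆ (c ∷ cs) ds es rewrite ++-assoc cs ds es = zip-⊆ (c ∷ cs) ds cs (ds ++ es)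

Unique⇒length≤ : ∀ {n} {xs : List (Fin n)} → Unique xs → length xs ≤ n
Unique⇒length≤ u = injective⇒≤ (Unique⇒lookup-injective u)

-- Kernels of relations

fromDec : ∀ {n} {P : Pred (Fin n) 0ℓ} → Decidable₁ P →
  ∃[ S ] (∀ {x} → x ∈ S → P x) × (∀ {x} → P x → x ∈ S)
fromDec {n} {P} P? = tabulate (does ∘ P?) , to , from
  where
  to : ∀ {x} → x ∈ tabulate (does ∘ P?) → P x
  to {x} x∈S with P? x | trans (sym (lookup∘tabulate (does ∘ P?) x)) ([]=⇒lookup x∈S)
  ... | yes p | _ = p

  from : ∀ {x} → P x → x ∈ tabulate (does ∘ P?)
  from {x} p = lookup⇒[]= x _ (trans (lookup∘tabulate (does ∘ P?) x) (dec-true (P? x) p))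

module _ {n : ℕ} {R : Rel (Fin n) 0ℓ} (R? : Decidable R) where

  -- Ties between vertices related in both directions are broken by the index.
  _⊏_ : Rel (Fin n) 0ℓ
  w ⊏ x = R x w × (R w x → w Fin.< x)

  _⊏?_ : Decidable _⊏_
  w ⊏? x = R? x w ×-dec (R? w x →-dec w Fin.<? x)

  -- The lost and the won positions of the game whose moves lead from `x` to some `w ⊏ x`. As
  -- inductive types they are disjoint outright; that every position is one or the other comes from
  -- accessibility.
  mutual
    data Chosen (x : Fin n) : Set where
      chosen : (∀ w → w ⊏ x → Rejected w) → Chosen x

    data Rejected (x : Fin n) : Set where
      rejected : ∀ w → w ⊏ x → Chosen w → Rejected x

  ¬chosen×rejected : ∀ {x} → Chosen x → ¬ Rejected x
  ¬chosen×rejected (chosen f) (rejected w w⊏x c) = ¬chosen×rejected c (f w w⊏x)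

  chosen⊎rejected : ∀ {x} → Acc _⊏_ x → Chosen x ⊎ Rejected x
  chosen? : ∀ {x} → Acc _⊏_ x → Dec (Chosen x)

  chosen? a with chosen⊎rejected a
  ... | inj₁ c = yes c
  ... | inj₂ r = no λ c → ¬chosen×rejected c r

  chosen⊎rejected {x} (acc rs) with any? chosenBelow?
    where
    chosenBelow? : ∀ w → Dec (Σ[ _ ∈ w ⊏ x ] Chosen w)
    chosenBelow? w with w ⊏? x
    ... | no w⋢x  = no (w⋢x ∘ proj₁)
    ... | yes w⊏x = map′ (w⊏x ,_) proj₂ (chosen? (rs w⊏x))
  ... | yes (w , w⊏x , c) = inj₂ (rejected w w⊏x c)
  ... | no ¬below = inj₁ (chosen below)
    where
    below : ∀ w → w ⊏ x → Rejected w
    below w w⊏x with chosen⊎rejected (rs w⊏x)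
    ... | inj₁ c = contradiction (w , w⊏x , c) ¬below
    ... | inj₂ r = r

  -- Distinct vertices related by `R` in some direction are comparable by `⊏`, so two chosen ones
  -- are never related; a rejected vertex carries a chosen vertex that absorbs it.
  wellFounded⇒kernel : WellFounded _⊏_ →
    ∃[ S ] (∀ u v → u ∈ S → v ∈ S → u ≢ v → ¬ R u v) ×
           (∀ x → x ∉ S → ∃[ s ] s ∈ S × R x s)
  wellFounded⇒kernel wf with fromDec (λ x → chosen? (wf x))
  ... | S , ∈S⇒chosen , chosen⇒∈S = S , independent , absorbent
    where
    ⊏⇒¬bothChosen : ∀ {w x} → w ⊏ x → Chosen x → ¬ Chosen w
    ⊏⇒¬bothChosen w⊏x cx cw = ¬chosen×rejected cx (rejected _ w⊏x cw)

    independent : ∀ u v → u ∈ S → v ∈ S → u ≢ v → ¬ R u v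
    independent u v u∈S v∈S u≢v r with R? v u | Fin.<-cmp u v
    ... | no ¬r′ | _            = ⊏⇒¬bothChosen (r , λ r′ → contradiction r′ ¬r′) (∈S⇒chosen u∈S) (∈S⇒chosen v∈S)
    ... | yes r′ | tri< u<v _ _  = ⊏⇒¬bothChosen (r′ , λ _ → u<v) (∈S⇒chosen v∈S) (∈S⇒chosen u∈S)
    ... | yes r′ | tri≈ _ u≡v _  = u≢v u≡v
    ... | yes r′ | tri> _ _ v<u  = ⊏⇒¬bothChosen (r , λ _ → v<u) (∈S⇒chosen u∈S) (∈S⇒chosen v∈S)

    absorbent : ∀ x → x ∉ S → ∃[ s ] s ∈ S × R x s
    absorbent x x∉S with chosen⊎rejected (wf x)
    ... | inj₁ c                      = contradiction (chosen⇒∈S c) x∉S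
    ... | inj₂ (rejected w (r , _) c) = w , chosen⇒∈S c , r

  module _ {T : Rel (Fin n) 0ℓ} (T-trans : Transitive T) (R⇒T : ∀ {x y} → R x y → T x y)
           (T-sym⇒R : ∀ {x y} → T x y → T y x → R x y) where

    -- Putting `T` for `R` in the definition of `⊏` gives a larger relation, which is a strict
    -- partial order on a finite set.
    ⊏-wellFounded : WellFounded _⊏_
    ⊏-wellFounded = Subrelation.wellFounded ⊏⇒⊏ᵀ (spo-wellFounded isSPO)
      where
      _⊏ᵀ_ : Rel (Fin n) 0ℓ
      w ⊏ᵀ x = T x w × (T w x → w Fin.< x)

      ⊏⇒⊏ᵀ : ∀ {w x} → w ⊏ x → w ⊏ᵀ x
      ⊏⇒⊏ᵀ (r , f) = R⇒T r , λ t → f (T-sym⇒R t (R⇒T r))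

      isSPO : IsStrictPartialOrder _≡_ _⊏ᵀ_
      isSPO = record
        { isEquivalence = isEquivalence
        ; irrefl        = λ { refl (t , f) → Fin.<-irrefl refl (f t) }
        -- A step of `T` back from the least to the greatest makes all three vertices mutually
        -- related, so both index comparisons apply.
        ; trans         = λ { (tyx , f) (tzy , g) → T-trans tzy tyx ,
                              λ txz → Fin.<-trans (f (T-trans txz tzy)) (g (T-trans tyx txz)) }
        ; <-resp-≈      = resp₂ _⊏ᵀ_
        }

-- Walks

module _ (D : Digraph) where

  open import Data.List.Membership.DecPropositional (Fin._≟_ {order D}) using (_∈?_)

  initials-◅◅ : ∀ {x y z} (V : Walk D x y) (W : Walk D y z) →
    initials D (V ◅◅ W) ≡ initials D V ++ initials D W
  initials-◅◅ ε       W = refl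
  initials-◅◅ (_ ◅ V) W = cong (_ ∷_) (initials-◅◅ V W)

  start∈ : ∀ {x y} (W : Walk D x y) → x ∈ₗ initials D W ∷ʳ y
  start∈ ε       = here refl
  start∈ (_ ◅ _) = here refl

  splitAt : ∀ {x y z} (W : Walk D x z) → y ∈ₗ initials D W →
    Σ[ V ∈ Walk D x y ] ∃[ w ] Σ[ a ∈ Arc D y w ] Σ[ W′ ∈ Walk D w z ] W ≡ V ◅◅ (a ◅ W′)
  splitAt (a ◅ W) (here refl) = ε , _ , a , W , refl
  splitAt (a ◅ W) (there y∈W) with splitAt W y∈W
  ... | V , _ , b , W′ , refl = a ◅ V , _ , b , W′ , refl

  rotate : ∀ {x y} (C : Walk D x x) → y ∈ₗ initials D C →
    Σ[ C′ ∈ Walk D y y ] initials D C ↭ initials D C′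
  rotate C y∈C with splitAt C y∈C
  ... | V , _ , a , W , refl = (a ◅ W) ◅◅ V ,
    ↭-trans (↭-reflexive (initials-◅◅ V (a ◅ W)))
      (↭-trans (++-comm (initials D V) _) (↭-reflexive (sym (initials-◅◅ (a ◅ W) V))))

  -- The walk is stopped at its first vertex in `S`, and the part between two visits to a vertex is
  -- dropped. The end `z` is not among the initial vertices, so a path on `S` starting at `z` can be
  -- appended.
  pathInto : ∀ {y u} S → Walk D y u → u ∈ₗ S →
    ∃[ z ] z ∈ₗ S × (Σ[ P ∈ Walk D y z ] Unique (initials D P) × Disjoint (initials D P) S)
  pathInto         S ε       u∈S = _ , u∈S , ε , [] , λ ()
  pathInto {y = y} S (a ◅ W) u∈S with y ∈? S
  ... | yes y∈S = _ , y∈S , ε , [] , λ ()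
  ... | no y∉S with pathInto S W u∈S
  ...   | z , z∈S , P , uP , P∩S with y ∈? initials D P
  ...     | no y∉P  = z , z∈S , a ◅ P , ¬Any⇒All¬ _ y∉P ∷ uP ,
                      λ { (here refl , y∈S) → y∉S y∈S ; (there v∈P , v∈S) → P∩S (v∈P , v∈S) }
  ...     | yes y∈P with splitAt P y∈P
  ...       | V , _ , b , P′ , refl rewrite initials-◅◅ V (b ◅ P′) =
    z , z∈S , b ◅ P′ , Unique-resp-⊇ (++⁺ˡ (initials D V) ⊆-refl) uP ,
    λ { (v∈P , v∈S) → P∩S (∈-++⁺ʳ (initials D V) v∈P , v∈S) }

  -- Only the last arc changes: it now leads to `y`.
  redirect : ∀ {x y z} (W : Walk D x z) → 1 ≤ length (initials D W) →
    All (λ v → Arc D v y) (initials D W) → Σ[ W′ ∈ Walk D x y ] initials D W′ ≡ initials D W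
  redirect (a ◅ ε)     _ (b ∷ _)  = b ◅ ε , refl
  redirect (a ◅ c ◅ W) _ (_ ∷ bs) with redirect (c ◅ W) (s≤s z≤n) bs
  ... | W′ , eq = a ◅ W′ , cong (_ ∷_) eq

  walk? : ∀ n {x y} {P : Walk D x y → Set} → (∀ W → Dec (P W)) →
    Dec (Σ[ W ∈ Walk D x y ] length (initials D W) ≤ n × P W)
  walkStartingAt? : ∀ n {x y} {P : Walk D x y → Set} → (∀ W → Dec (P W)) → ∀ w →
    Dec (Σ[ a ∈ Arc D x w ] Σ[ W ∈ Walk D w y ] length (initials D W) ≤ n × P (a ◅ W))
  emptyWalk? : ∀ {x y} {P : Walk D x y → Set} → (∀ W → Dec (P W)) →
    Dec (Σ[ W ∈ Walk D x y ] length (initials D W) ≤ 0 × P W)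

  emptyWalk? {x} {y} P? with x Fin.≟ y
  ... | no x≢y = no λ { (ε , _) → x≢y refl }
  ... | yes refl with P? ε
  ...   | yes p = yes (ε , z≤n , p)
  ...   | no ¬p = no λ { (ε , _ , p) → ¬p p }

  walkStartingAt? n {x} {P = P} P? w with T? (adj D x w)
  ... | no ¬a = no (¬a ∘ proj₁)
  -- `P` may depend on the proof of the arc, but there is only one such proof.
  ... | yes a = map′ (a ,_) (λ { (b , W , l , p) → W , l , subst (λ c → P (c ◅ W)) (T-irrelevant b a) p })
                  (walk? n (λ W → P? (a ◅ W)))

  walk? zero    P? = emptyWalk? P?
  walk? (suc n) P? with emptyWalk? P? | any? (walkStartingAt? n P?)
  ... | yes (W , l , p) | _ = yes (W , ≤-trans l z≤n , p)
  ... | no _   | yes (_ , a , W , l , p) = yes (a ◅ W , s≤s l , p)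
  ... | no ¬e  | no ¬s = no λ { (ε , _ , p) → ¬e (ε , z≤n , p) ; (a ◅ W , s≤s l , p) → ¬s (_ , a , W , l , p) }

-- Cycles in local out-tournaments

  IsCycle-resp-↭ : ∀ {x y} (C : Walk D x x) (C′ : Walk D y y) →
    initials D C ↭ initials D C′ → IsCycle D C → IsCycle D C′
  IsCycle-resp-↭ C C′ p (l , u) = subst (1 ≤_) (↭-length p) l , Unique-resp-↭ p u

  module _ (loopless : Loopless D) (local : LocalOutTournament D) where

    -- Both `y` and the next vertex `x′` are out-neighbours of the current vertex, hence adjacent.
    -- If `y` dominates `x′`, then `y` fits in between; otherwise `x′` dominates `y` and the
    -- argument moves on to `x′`.
    insert : ∀ {x y z} (W : Walk D x z) → Arc D x y → y ∉ₗ initials D W ∷ʳ z →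
      (Σ[ W′ ∈ Walk D x z ] y ∷ initials D W ↭ initials D W′) ⊎
      All (λ v → Arc D v y) (initials D W)
    insert ε b _ = inj₂ []
    insert {y = y} (_◅_ {j = x′} a W) b y∉W
      with proj₂ (local _) y x′ b a (λ { refl → y∉W (there (start∈ W)) })
    ... | inj₁ (c , _) = inj₁ (b ◅ c ◅ W , swap _ _ ↭-refl)
    ... | inj₂ (c , _) with insert W c (y∉W ∘ there)
    ...   | inj₁ (W′ , p) = inj₁ (a ◅ W′ , ↭-trans (swap _ _ ↭-refl) (prep _ p))
    ...   | inj₂ bs       = inj₂ (b ∷ bs)

    -- The base point `x` will travel along a walk while `u` stays on the cycle.
    CycleThrough : Vertex D → Vertex D → Set
    CycleThrough x u = Σ[ C ∈ Walk D x x ] IsCycle D C × u ∈ₗ initials D C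

    rebase : ∀ {x y u} (C : CycleThrough x u) → y ∈ₗ initials D (proj₁ C) → CycleThrough y u
    rebase (C , cyc , u∈C) y∈C with rotate C y∈C
    ... | C′ , p = C′ , IsCycle-resp-↭ C C′ p cyc , ∈-resp-↭ p u∈C

    extend : ∀ {x y u} (C : CycleThrough x u) → Arc D x y → y ∉ₗ initials D (proj₁ C) →
      Walk D y u → CycleThrough y u
    extend {x} {y} (C , (l , uC) , u∈C) b y∉C W with insert C b y∉C∷ʳx
      where
      y∉C∷ʳx : y ∉ₗ initials D C ∷ʳ x
      y∉C∷ʳx y∈ with ∈-++⁻ (initials D C) y∈
      ... | inj₁ y∈C         = y∉C y∈C
      ... | inj₂ (here refl) = loopless _ b
    ... | inj₁ (C′ , p) = rebase (C′ , (∈-length (∈-resp-↭ p (here refl)) , Unique-resp-↭ p (¬Any⇒All¬ _ y∉C ∷ uC)) ,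
                                  ∈-resp-↭ p (there u∈C)) (∈-resp-↭ p (here refl))
    -- All of `C` dominates `y`: follow `W` from `y` to its first vertex `z` on `C`, run through all
    -- of `C` from `z`, and take the last arc to `y` instead of `z`.
    ... | inj₂ bs with pathInto (initials D C) W u∈C
    ...   | z , z∈C , P , uP , P∩C with rotate C z∈C
    ...     | C′ , p with redirect C′ (subst (1 ≤_) (↭-length p) l) (All-resp-↭ p bs)
    ...       | Q , eq = P ◅◅ Q , (∈-length u∈ , unique) , u∈
      where
      C↭Q : initials D C ↭ initials D Q
      C↭Q = ↭-trans p (↭-reflexive (sym eq))

      u∈ : _ ∈ₗ initials D (P ◅◅ Q)
      u∈ rewrite initials-◅◅ P Q = ∈-++⁺ʳ (initials D P) (∈-resp-↭ C↭Q u∈C)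

      unique : Unique (initials D (P ◅◅ Q))
      unique rewrite initials-◅◅ P Q = Unique.++⁺ uP (Unique-resp-↭ C↭Q uC)
        λ { (v∈P , v∈Q) → P∩C (v∈P , ∈-resp-↭ (↭-sym C↭Q) v∈Q) }

    closedWalk⇒cycle : ∀ {v w} → Arc D v w → Walk D w v → CycleThrough v v
    closedWalk⇒cycle {v} a W with pathInto [ v ] W (here refl)
    ... | _ , here refl , P , uP , P∩v = a ◅ P , (s≤s z≤n , ¬Any⇒All¬ _ (λ v∈P → P∩v (v∈P , here refl)) ∷ uP) , here refl

    -- The cycle is rotated if it contains the next vertex and extended if not; in the latter case
    -- the rest of `W` followed by `Z` leads back to the cycle, at `u` at the latest.
    cycleAlong : ∀ {w v u} → Walk D w v → Walk D v u → CycleThrough w u → CycleThrough v u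
    cycleAlong ε Z C = C
    cycleAlong (_◅_ {j = w′} a W) Z C with w′ ∈? initials D (proj₁ C)
    ... | yes w′∈C = cycleAlong W Z (rebase C w′∈C)
    ... | no w′∉C  = cycleAlong W Z (extend C a w′∉C (W ◅◅ Z))

-- H-lengths

module _ (D H : Digraph) (ρ : Colouring D H) where

  colours-◅◅ : ∀ {x y z} (V : Walk D x y) (W : Walk D y z) →
    colours D H ρ (V ◅◅ W) ≡ colours D H ρ V ++ colours D H ρ W
  colours-◅◅ ε       W = refl
  colours-◅◅ (_ ◅ V) W = cong (_ ∷_) (colours-◅◅ V W)

  -- Obstructions inside `V` persist in the closed walk; `suc` is the extra 1 in the `H`-length of
  -- an open walk.
  openHLength≤closedHLength : ∀ {x y} (V : Walk D x y) (W : Walk D y x) →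
    openHLength D H ρ V ≤ suc (closedHLength D H ρ (V ◅◅ W))
  openHLength≤closedHLength V W rewrite colours-◅◅ V W =
    s≤s (length-mono-≤ (filter⁺ _ _ (λ { refl → id }) (consecutive-⊆ (colours D H ρ V) (colours D H ρ W) _)))

  ShortPath : ℕ → Vertex D → Vertex D → Set
  ShortPath m u v = Σ[ W ∈ Walk D u v ] IsPath D W × openHLength D H ρ W ≤ m

  -- The search is finite since a path has at most `order D` vertices.
  shortPath? : ∀ m → Decidable (ShortPath m)
  shortPath? m u v = map′ (λ { (W , _ , p) → W , p }) (λ { (W , path , l) → W , length≤ W path , path , l })
    (walk? D (order D) λ W → DecUnique.unique? Fin._≟_ _ ×-dec (openHLength D H ρ W ≤? m))
    where
    length≤ : (W : Walk D u v) → IsPath D W → length (initials D W) ≤ order D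
    length≤ W path = Unique⇒length≤ (Unique-resp-⊇ (++⁺ʳ [ v ] ⊆-refl) path)

  cyclesShort⇒shortPath : ∀ {m} → Loopless D → LocalOutTournament D →
    (∀ x (C : Walk D x x) → IsCycle D C → closedHLength D H ρ C ≤ m) →
    ∀ {u v} → Walk D u v → Walk D v u → ShortPath (suc m) u v
  cyclesShort⇒shortPath loopless local short W ε = ε , [] ∷ [] , s≤s z≤n
  cyclesShort⇒shortPath loopless local short {u} {v} W (a ◅ V)
    -- Start with a cycle at `v` and carry its base point to `u`, keeping `v` on it; the part from
    -- `u` to `v` is the path sought.
    with cycleAlong D loopless local (a ◅ V) W (closedWalk⇒cycle D loopless local a (V ◅◅ W))
  ... | C , cyc , v∈C with splitAt D C v∈C
  ...   | P , _ , b , Q , refl = P , path , ≤-trans (openHLength≤closedHLength P (b ◅ Q)) (s≤s (short _ _ cyc))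
    where
    path : IsPath D P
    path = Unique-resp-⊇ (++⁺ ⊆-refl (refl ∷ minimum _)) (subst Unique (initials-◅◅ D P (b ◅ Q)) (proj₂ cyc))

theorem28 : (k : ℕ) → 2 ≤ k →
    (H D : Digraph) (ρ : Colouring D H) →
    Loopless D → LocalOutTournament D →
    (∀ x (C : Walk D x x) → IsCycle D C → closedHLength D H ρ C ≤ k ∸ 2) →
    ∃[ S ] IsKernel D H ρ k S
theorem28 (suc (suc m)) (s≤s (s≤s _)) H D ρ loopless local short =
  -- Here `k` is `m + 2`: cycles have `H`-length at most `m`, short paths at most `m + 1`, that is
  -- `k - 1`. Reachability by walks serves as `T`.
  let S , independent , absorbent = wellFounded⇒kernel (shortPath? D H ρ (suc m))
        (⊏-wellFounded (shortPath? D H ρ (suc m)) _◅◅_ proj₁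
          (cyclesShort⇒shortPath D H ρ loopless local short))
  in S , (λ u v u∈S v∈S u≢v W path → ≰⇒> λ l → independent u v u∈S v∈S u≢v (W , path , l)) , absorbent
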